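{- Let $s\ge 3$ and $q\ge 1$ be integers, let $G$ be an $(s,q)$-first-failing graph, and let $Y\subseteq G$ be a subgraph with $\chi(Y)=h$. Then $Y$ contains a family of pairwise vertex-disjoint cycles of length $s$ of size at least $$\frac1s M_s(h-q-1),$$ with the bound interpreted as $0$ if $h-q-1<1$. Moreover, if $c=\lceil h/q\rceil$, then $Y$ contains a family of pairwise edge-disjoint cycles of length $s$ of size at least $$\frac{c-1}{2s}M_s(c-1),$$ again interpreted as $0$ when $c-1<1$.
   Context: All graphs are finite and simple; subgraphs need not be induced. $\chi$ is the chromatic number. The girth of a forest is $\infty$. A graph $G$ is $(s,q)$-first-failing if (i) $\operatorname{girth}(G)\ge s$, and (ii) every subgraph of $G$ containing no cycle of length exactly $s$ is $q$-colourable. For $d\ge1$, $M_s(d)$ is the Moore bound $$M_s(d)=\begin{cases}1+d\sum_{i=0}^{a-1}(d-1)^i, & s=2a+1,\\ 2\sum_{i=0}^{a-1}(d-1)^i, & s=2a,\end{cases}$$ with the convention $0^0=1$. -}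

module Defs where

open import Data.Bool using (if_then_else_)
open import Data.Fin using (Fin; toℕ)
open import Data.List using (map; upTo)
open import Data.Nat
open import Data.Nat.DivMod using (_/_; _%_)
open import Data.Nat.ListAction using (sum)
open import Data.Product using (Σ-syntax; ∃-syntax; _×_)
open import Data.Sum using (_⊎_)
open import Function.Definitions using (Injective)
open import Level using (0ℓ)
open import Relation.Binary.Construct.Add.Supremum.NonStrict _≤_ using (_≤⁺_)
open import Relation.Binary.Core using (Rel)
import Relation.Binary.Definitions as B
open import Relation.Binary.PropositionalEquality using (_≡_; _≢_)
open import Relation.Nullary using (¬_)
open import Relation.Nullary.Construct.Add.Supremum using (_⁺; [_]; ⊤⁺)
open import Relation.Unary using (Pred)
import Relation.Unary as U

-- Finite simple graphs whose vertex set is a subset of an ambient Fin n,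
-- so that a graph and all its subgraphs inhabit the same type.
record Graph (n : ℕ) : Set₁ where
  infix 4 _~_
  field
    V       : Pred (Fin n) 0ℓ
    _~_     : Rel (Fin n) 0ℓ
    V?      : U.Decidable V
    _~?_    : B.Decidable _~_
    ~-sym   : B.Symmetric _~_
    ~-irrefl : ∀ {v} → ¬ (v ~ v)
    ~⇒V     : ∀ {u v} → u ~ v → V u

open Graph using (V)

infix 4 _⊆_
_⊆_ : ∀ {n} → Graph n → Graph n → Set
H ⊆ G = (∀ {v} → V H v → V G v) × (∀ {u v} → u ~ₕ v → u ~ v)
  where
  open Graph G using (_~_)
  open Graph H using () renaming (_~_ to _~ₕ_)

-- Colours are natural numbers below k, rather than elements of Fin k, so that
-- a colouring need not provide a colour for points of Fin n outside V;
-- in particular the graph without vertices is 0-colourable.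
Colourable : ∀ {n} → Graph n → ℕ → Set
Colourable {n} G k = Σ[ f ∈ (Fin n → ℕ) ]
  (∀ {v} → V G v → f v < k) × (∀ {u v} → u ~ v → f u ≢ f v)
  where open Graph G using (_~_)

IsChromaticNumber : ∀ {n} → Graph n → ℕ → Set
IsChromaticNumber G h = Colourable G h × (∀ k → Colourable G k → h ≤ k)

-- j is the successor of i in the cyclic order 0, 1, …, ℓ - 1, 0.
CyclicSuc : ∀ {ℓ} → Rel (Fin ℓ) 0ℓ
CyclicSuc {ℓ} i j =
  toℕ j ≡ suc (toℕ i) ⊎ (suc (toℕ i) ≡ ℓ × toℕ j ≡ 0)

record Cycle {n} (G : Graph n) (ℓ : ℕ) : Set where
  open Graph G using (_~_)
  field
    3≤length  : 3 ≤ ℓ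
    vertex    : Fin ℓ → Fin n
    injective : Injective _≡_ _≡_ vertex
    adjacent  : ∀ {i j} → CyclicSuc i j → vertex i ~ vertex j

  HasVertex : Fin n → Set
  HasVertex v = ∃[ i ] v ≡ vertex i

  HasEdge : Fin n → Fin n → Set
  HasEdge u v = ∃[ i ] ∃[ j ] (CyclicSuc i j ×
    ((u ≡ vertex i × v ≡ vertex j) ⊎ (u ≡ vertex j × v ≡ vertex i)))

open Cycle using (HasVertex; HasEdge)

VertexDisjoint : ∀ {n ℓ} {G : Graph n} → Rel (Cycle G ℓ) 0ℓ
VertexDisjoint C D = ∀ v → HasVertex C v → ¬ HasVertex D v

EdgeDisjoint : ∀ {n ℓ} {G : Graph n} → Rel (Cycle G ℓ) 0ℓ
EdgeDisjoint C D = ∀ u v → HasEdge C u v → ¬ HasEdge D u v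

Pairwise : ∀ {A : Set} {t} → Rel A 0ℓ → (Fin t → A) → Set
Pairwise R C = ∀ i j → i ≢ j → R (C i) (C j)

IsGirth : ∀ {n} → Graph n → ℕ ⁺ → Set
IsGirth G [ g ] = Cycle G g × (∀ ℓ → Cycle G ℓ → g ≤ ℓ)
IsGirth G ⊤⁺    = ∀ ℓ → ¬ Cycle G ℓ

FirstFailing : ∀ {n} → ℕ → ℕ → Graph n → Set₁
FirstFailing s q G =
    (∃[ g ] (IsGirth G g × [ s ] ≤⁺ g))
  × (∀ H → H ⊆ G → ¬ Cycle H s → Colourable H q)

-- The Moore bound M_s(d) for d ≥ 1, with e = d - 1. The value at d = 0 is not
-- the formula: it is the convention that a bound involving M_s(d) with d < 1
-- is read as 0.
moore : ℕ → ℕ → ℕ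
moore s zero    = 0
moore s (suc e) = if s % 2 ≡ᵇ 0 then 2 * geometric else 1 + suc e * geometric
  where
  geometric : ℕ
  geometric = sum (map (e ^_) (upTo (s / 2)))

⌈_/_⌉ : ℕ → (q : ℕ) .{{_ : NonZero q}} → ℕ
⌈ h / q ⌉ = (h + (q ∸ 1)) / q

{-# OPTIONS --safe #-}

-- Delete a maximal family of disjoint s-cycles from Y (their vertices, or their edges): what is left
-- has no s-cycle, so it is q-colourable. If the deleted part (the subgraph of Y induced on the
-- vertices, or the union of the cycles) were colourable with too few colours, combining the two
-- colourings (with disjoint palettes, or with pairs of colours) would colour Y with fewer than h
-- colours. So greedy colouring of the deleted part gets stuck at a subgraph of minimum degree at
-- least h - q - 1 (or c - 1). Its girth is at least s, so the Moore bound applies, and its vertices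
-- (or edges) are among the s * t vertices (or edges) of the t cycles.
module Submission where

open import Defs
open import Data.Bool using (if_then_else_)
open import Data.Fin using (Fin; zero; suc; toℕ; fromℕ<; combine)
open import Data.Fin.Properties as Fin
  using (any?; all?; injective⇒≤; toℕ-injective; toℕ<n; toℕ-fromℕ<; combine-injective)
open import Data.List
  using (List; []; _∷_; _++_; _∷ʳ_; length; lookup; map; filter; concatMap; upTo; applyUpTo;
         allFin)
open import Data.List.Membership.Propositional using (_∈_; _∉_; find; lose)
open import Data.List.Membership.Propositional.Properties
  using (∈-filter⁺; ∈-filter⁻; ∈-map⁺; ∈-map⁻; ∈-++⁻; ∈-∃++; ∈-lookup; ∈-allFin;
         ∈-upTo⁻; ∈-concatMap⁻)
open import Data.List.Properties
  using (length-++; length-map; length-applyUpTo; map-applyUpTo; map-upTo; filter-all; filter-notAll)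
open import Data.List.Relation.Binary.Disjoint.Propositional using (Disjoint)
import Data.List.Relation.Binary.Subset.Propositional as List
open import Data.List.Relation.Unary.All as All using ([]; _∷_)
open import Data.List.Relation.Unary.All.Properties using (++⁻; ¬Any⇒All¬)
open import Data.List.Relation.Unary.AllPairs using ([]; _∷_)
open import Data.List.Relation.Unary.Any as Any using (here; there)
open import Data.List.Relation.Unary.Any.Properties using (lookup-index)
open import Data.List.Relation.Unary.Linked using (Linked; [-]; _∷_)
open import Data.List.Relation.Unary.Unique.Propositional using (Unique)
open import Data.List.Relation.Unary.Unique.Propositional.Properties
  using (++⁺; map⁺; filter⁺; allFin⁺; upTo⁺; Unique[x∷xs]⇒x∉xs)
open import Data.Nat
open import Data.Nat.DivMod
  using (_/_; _%_; m%n<n; m≡m%n+[m/n]*n; m/n*n≤m; m<n⇒m%n≡m; [m+kn]%n≡m%n)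
open import Data.Nat.ListAction using (sum)
open import Data.Nat.Properties
open import Data.Product using (Σ-syntax; ∃; ∃-syntax; _×_; _,_; proj₁; proj₂)
open import Data.Sum using (_⊎_; inj₁; inj₂)
import Data.Vec as Vec
import Data.Vec.Functional as Vector
import Data.Vec.Properties as Vec
open import Function using (_∘_; id)
open import Function.Definitions using (Injective)
open import Level using (0ℓ)
open import Relation.Binary using (Rel; Symmetric)
open import Relation.Binary.Construct.Add.Supremum.NonStrict _≤_
  using (_≤⁺_; _≤⊤⁺) renaming ([_] to [_]⁺)
open import Relation.Binary.PropositionalEquality
open import Relation.Nullary using (¬_; Dec; yes; no; contradiction)
open import Relation.Nullary.Construct.Add.Supremum using () renaming ([_] to [_]⊤)
open import Relation.Nullary.Decidable using (map′; ¬?; _×-dec_; _⊎-dec_; _→-dec_; decidable-stable)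
open import Relation.Unary using (Decidable)

open Cycle using (HasVertex; HasEdge)

-- Repetition-free lists and counting by injections.

lookup-injective : {A : Set} {xs : List A} → Unique xs → Injective _≡_ _≡_ (lookup xs)
lookup-injective (_ ∷ _)   {zero}  {zero}  _  = refl
lookup-injective (x∉ ∷ _)  {zero}  {suc j} eq = contradiction eq (All.lookup x∉ (∈-lookup j))
lookup-injective (x∉ ∷ _)  {suc i} {zero}  eq = contradiction (sym eq) (All.lookup x∉ (∈-lookup i))
lookup-injective (_ ∷ xs!) {suc i} {suc j} eq = cong suc (lookup-injective xs! eq)

-- `code` may read its value off the membership proof, so one element may receive several codes;
-- equal codes need only force equal elements. This fits the later counts, where an element comes
-- with a chosen cycle and a position on it.
unique-length-≤ : ∀ {A : Set} {N} {xs : List A} → Unique xs →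
                  (code : ∀ {x} → x ∈ xs → Fin N) →
                  (∀ {x y} (p : x ∈ xs) (q : y ∈ xs) → code p ≡ code q → x ≡ y) →
                  length xs ≤ N
unique-length-≤ xs! code code-injective =
  injective⇒≤ {f = λ i → code (∈-lookup i)}
    (λ eq → lookup-injective xs! (code-injective (∈-lookup _) (∈-lookup _) eq))

unique-⊆-length : {A : Set} {xs ys : List A} → Unique xs → xs List.⊆ ys → length xs ≤ length ys
unique-⊆-length {ys = ys} xs! xs⊆ys = unique-length-≤ xs! (Any.index ∘ xs⊆ys) λ p q eq →
  trans (lookup-index (xs⊆ys p)) (trans (cong (lookup ys) eq) (sym (lookup-index (xs⊆ys q))))

-- Pigeonhole: if every colour below `d` occurred, the `d` distinct entries of `upTo d` would all
-- lie in `xs`.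
fresh-below : ∀ {d} (xs : List ℕ) → length xs < d → ∃[ c ] (c < d × c ∉ xs)
fresh-below {d} xs |xs|<d with any? {d} (λ i → ¬? (Any.any? (toℕ i ≟_) xs))
... | yes (i , i∉xs) = toℕ i , toℕ<n i , i∉xs
... | no  none       = contradiction |xs|<d (≤⇒≯ (≤-trans (≤-reflexive (sym (length-applyUpTo id d)))
    (unique-⊆-length (upTo⁺ d) λ i∈ → covered (∈-upTo⁻ i∈))))
  where
  covered : ∀ {c} → c < d → c ∈ xs
  covered c<d = subst (_∈ xs) (toℕ-fromℕ< c<d)
    (decidable-stable (Any.any? (_ ≟_) xs) λ c∉xs → none (fromℕ< c<d , c∉xs))

unique-concatMap : ∀ {A B : Set} {f : A → List B} {xs} → Unique xs →
                   (∀ {x} → x ∈ xs → Unique (f x)) →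
                   (∀ {x y} → x ∈ xs → y ∈ xs → x ≢ y → Disjoint (f x) (f y)) →
                   Unique (concatMap f xs)
unique-concatMap         []          _   _        = []
unique-concatMap {f = f} (x∉ ∷ xs!) f! disjoint =
  ++⁺ (f! (here refl))
      (unique-concatMap xs! (f! ∘ there) λ p q → disjoint (there p) (there q))
      λ (v∈fx , v∈rest) → let y , y∈xs , v∈fy = find (∈-concatMap⁻ f v∈rest) in
        disjoint (here refl) (there y∈xs) (All.lookup x∉ y∈xs) (v∈fx , v∈fy)

length-concatMap-≥ : ∀ {A B : Set} {f : A → List B} {k} xs →
                     (∀ {x} → x ∈ xs → k ≤ length (f x)) →
                     length xs * k ≤ length (concatMap f xs)
length-concatMap-≥         []       _  = z≤n
length-concatMap-≥ {f = f} (x ∷ xs) k≤ = ≤-trans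
  (+-mono-≤ (k≤ (here refl)) (length-concatMap-≥ xs (k≤ ∘ there)))
  (≤-reflexive (sym (length-++ (f x))))

_≢?_ : ∀ {n} (y x : Fin n) → Dec (x ≢ y)
y ≢? x = ¬? (x Fin.≟ y)

-- Since `y` occurs at most once, forbidding the way back costs a vertex at most one of its
-- neighbours.
length-filter-≢ : ∀ {n} {xs : List (Fin n)} y → Unique xs →
                  length xs ≤ suc (length (filter (y ≢?_) xs))
length-filter-≢ y [] = z≤n
length-filter-≢ {xs = x ∷ xs} y (x∉ ∷ xs!) with x Fin.≟ y
... | yes refl = s≤s (≤-reflexive (sym (cong length (filter-all _ (All.map ≢-sym x∉)))))
... | no  _    = s≤s (length-filter-≢ y xs!)

-- Linked lists and the cyclic order of positions.

module _ {A : Set} {R : Rel A 0ℓ} where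

  linked-consecutive : ∀ xs {z} {i j : Fin (length xs)} → Linked R (xs ∷ʳ z) →
                       toℕ j ≡ suc (toℕ i) → R (lookup xs i) (lookup xs j)
  linked-consecutive (x ∷ y ∷ xs) {i = zero}  {suc zero} (r ∷ _)  _  = r
  linked-consecutive (x ∷ y ∷ xs) {i = suc i} {suc j}    (_ ∷ rs) eq =
    linked-consecutive (y ∷ xs) rs (suc-injective eq)

  linked-last : ∀ xs {z} {i : Fin (length xs)} → Linked R (xs ∷ʳ z) →
                suc (toℕ i) ≡ length xs → R (lookup xs i) z
  linked-last (x ∷ [])     {i = zero}  (r ∷ _)  _  = r
  linked-last (x ∷ y ∷ xs) {i = suc i} (_ ∷ rs) eq = linked-last (y ∷ xs) rs (suc-injective eq)

  linked-prefix : ∀ {w x zs} ys → Linked R (w ∷ ys ++ x ∷ zs) → Linked R (w ∷ ys ∷ʳ x)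
  linked-prefix []       (r ∷ _)  = r ∷ [-]
  linked-prefix (y ∷ ys) (r ∷ rs) = r ∷ linked-prefix ys rs

-- Serves to cut a closed segment out of a walk `x ∷ ys ++ x ∷ zs` whose tail is repetition-free:
-- the second visit to `x` moves to the front.
unique-rotate : ∀ {A : Set} {x : A} {zs} ys → Unique (ys ++ x ∷ zs) → Unique (x ∷ ys)
unique-rotate []       _          = [] ∷ []
unique-rotate (y ∷ ys) (y∉ ∷ u!) with unique-rotate ys u! | ++⁻ ys y∉
... | x∉ys ∷ ys! | y∉ys , (y≢x ∷ _) = (≢-sym y≢x ∷ x∉ys) ∷ (y∉ys ∷ ys!)

∃-cyclicSuc : ∀ {ℓ} (i : Fin ℓ) → ∃[ j ] CyclicSuc i j
∃-cyclicSuc {suc ℓ} i with suc (toℕ i) <? suc ℓ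
... | yes i<ℓ = fromℕ< i<ℓ , inj₁ (toℕ-fromℕ< i<ℓ)
... | no  i≮ℓ = zero , inj₂ (≤-antisym (toℕ<n i) (≮⇒≥ i≮ℓ) , refl)

cyclicSuc-functional : ∀ {ℓ} {i j k : Fin ℓ} → CyclicSuc i j → CyclicSuc i k → j ≡ k
cyclicSuc-functional (inj₁ p)       (inj₁ q)       = toℕ-injective (trans p (sym q))
cyclicSuc-functional (inj₂ (_ , p)) (inj₂ (_ , q)) = toℕ-injective (trans p (sym q))
cyclicSuc-functional {j = j} (inj₁ p) (inj₂ (q , _)) = contradiction (trans p q) (<⇒≢ (toℕ<n j))
cyclicSuc-functional {k = k} (inj₂ (q , _)) (inj₁ p) = contradiction (trans p q) (<⇒≢ (toℕ<n k))

-- The sum inside `moore`, with the number of terms made a parameter to allow induction; at `s / 2`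
-- it unfolds to the sum there.
geometric : ℕ → ℕ → ℕ
geometric e a = sum (map (e ^_) (upTo a))

-- Horner's form: one root plus `e` copies of the smaller sum, which is how the trees in the Moore
-- bound grow.
geometric-suc : ∀ e a → geometric e (suc a) ≡ 1 + e * geometric e a
geometric-suc e a = begin
  1 + sum (map (e ^_) (applyUpTo suc a)) ≡⟨ cong (λ l → 1 + sum l) (map-applyUpTo suc (e ^_) a) ⟩
  1 + sum (applyUpTo (λ i → e * e ^ i) a) ≡⟨ cong suc (sum-applyUpTo-* (e ^_) a) ⟩
  1 + e * sum (applyUpTo (e ^_) a) ≡⟨ cong (λ l → 1 + e * sum l) (map-upTo (e ^_) a) ⟨
  1 + e * geometric e a ∎
  where
  open ≡-Reasoning
  sum-applyUpTo-* : ∀ f a → sum (applyUpTo (λ i → e * f i) a) ≡ e * sum (applyUpTo f a)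
  sum-applyUpTo-* f zero    = sym (*-zeroʳ e)
  sum-applyUpTo-* f (suc a) =
    trans (cong (e * f 0 +_) (sum-applyUpTo-* (f ∘ suc) a)) (sym (*-distribˡ-+ e _ _))

-- Closed walks, non-backtracking walks and cycles.

module _ {n} (H : Graph n) where
  open Graph H
  open import Data.List.Membership.DecPropositional (Fin._≟_ {n}) using (_∈?_)

  nbrs : Fin n → List (Fin n) → List (Fin n)
  nbrs x = filter (x ~?_)

  closedWalk⇒Cycle : ∀ {x ys} → 3 ≤ suc (length ys) → Unique (x ∷ ys) →
                     Linked _~_ (x ∷ ys ∷ʳ x) → Cycle H (suc (length ys))
  closedWalk⇒Cycle {x} {ys} 3≤ x∷ys! links = record
    { 3≤length  = 3≤
    ; vertex    = lookup (x ∷ ys)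
    ; injective = lookup-injective x∷ys!
    ; adjacent  = λ where
        (inj₁ j≡1+i)               → linked-consecutive (x ∷ ys) links j≡1+i
        {j = zero} (inj₂ (i≡ , _)) → linked-last (x ∷ ys) links i≡
    }

  data NonBacktracking : List (Fin n) → Set where
    single : ∀ {x} → NonBacktracking (x ∷ [])
    edge   : ∀ {x y} → x ~ y → NonBacktracking (x ∷ y ∷ [])
    step   : ∀ {x y z zs} → x ~ y → x ≢ z → NonBacktracking (y ∷ z ∷ zs) →
             NonBacktracking (x ∷ y ∷ z ∷ zs)

  nb⇒linked : ∀ {xs} → NonBacktracking xs → Linked _~_ xs
  nb⇒linked single        = [-]
  nb⇒linked (edge r)      = r ∷ [-]
  nb⇒linked (step r _ nb) = r ∷ nb⇒linked nb

  -- A return after one step would be a loop, and a return after two steps would backtrack.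
  nb-return : ∀ {x zs} ys → NonBacktracking (x ∷ ys ++ x ∷ zs) → 3 ≤ suc (length ys)
  nb-return []           (edge r)       = contradiction r ~-irrefl
  nb-return []           (step r _ _)   = contradiction r ~-irrefl
  nb-return (_ ∷ [])     (step _ x≢x _) = contradiction refl x≢x
  nb-return (_ ∷ _ ∷ ys) _              = s≤s (s≤s (s≤s z≤n))

  -- A shortest segment of a non-backtracking walk between two visits to the same vertex is a cycle.
  nb⇒unique : ∀ {s} → (∀ ℓ → Cycle H ℓ → s ≤ ℓ) →
              ∀ {xs} → NonBacktracking xs → length xs ≤ s → Unique xs
  nb⇒unique s≤girth single _ = [] ∷ []
  nb⇒unique s≤girth (edge r) _ = ((λ { refl → ~-irrefl r }) ∷ []) ∷ ([] ∷ [])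
  nb⇒unique s≤girth {x ∷ xs} nb@(step _ _ nb′) |xs|<s
    with nb⇒unique s≤girth nb′ (<⇒≤ |xs|<s) | x ∈? xs
  ... | xs! | no  x∉xs = ¬Any⇒All¬ xs x∉xs ∷ xs!
  ... | xs! | yes x∈xs with ys , zs , eq ← ∈-∃++ x∈xs = contradiction
    -- This cycle has length `1 + length ys`, at most `length xs`, hence below `s`.
    (s≤girth _ (closedWalk⇒Cycle
      (nb-return ys (subst (λ l → NonBacktracking (x ∷ l)) eq nb))
      (unique-rotate ys (subst Unique eq xs!))
      (linked-prefix ys (subst (λ l → Linked _~_ (x ∷ l)) eq (nb⇒linked nb)))))
    (<⇒≱ (<-≤-trans (s≤s (≤-trans (s≤s (m≤m+n _ _)) (≤-reflexive (sym |xs|)))) |xs|<s))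
    where
    |xs| : length xs ≡ suc (length ys + length zs)
    |xs| = trans (cong length eq) (trans (length-++ ys) (+-suc _ _))

  -- Greedy colouring

  -- The obstruction to greedy colouring; `root` records that it is nonempty. Lists are used so that
  -- deleting a vertex is filtering, while the ambient graph `H` and its girth stay fixed.
  record Core (d : ℕ) (W : List (Fin n)) : Set where
    field
      vertices : List (Fin n)
      unique   : Unique vertices
      ⊆-bound  : vertices List.⊆ W
      root     : Fin n
      root∈    : root ∈ vertices
      degree≥  : ∀ {x} → x ∈ vertices → d ≤ length (nbrs x vertices)

  ColourableOn : ℕ → List (Fin n) → Set
  ColourableOn d W = Σ[ f ∈ (Fin n → ℕ) ]
    (∀ {v} → v ∈ W → f v < d) × (∀ {u v} → u ∈ W → v ∈ W → u ~ v → f u ≢ f v)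

  -- The neighbours of `v` use fewer than `d` colours, so one is left for `v`.
  extend-colouring : ∀ {d W} v → length (nbrs v W) < d →
                     ColourableOn d (filter (v ≢?_) W) → ColourableOn d W
  extend-colouring {d} {W} v deg<d (f , f<d , f-proper)
    with c , c<d , c∉ ← fresh-below (map f (nbrs v W)) (subst (_< d) (sym (length-map f (nbrs v W))) deg<d)
    = f′ , f′<d , f′-proper
    where
    f′ : Fin n → ℕ
    f′ w with w Fin.≟ v
    ... | yes _ = c
    ... | no  _ = f w

    f′<d : ∀ {w} → w ∈ W → f′ w < d
    f′<d {w} w∈W with w Fin.≟ v
    ... | yes _   = c<d
    ... | no  w≢v = f<d (∈-filter⁺ (v ≢?_) w∈W w≢v)

    c-fresh : ∀ {w} → w ∈ W → v ~ w → c ≢ f w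
    c-fresh w∈W v~w refl = c∉ (∈-map⁺ f (∈-filter⁺ (v ~?_) w∈W v~w))

    f′-proper : ∀ {u w} → u ∈ W → w ∈ W → u ~ w → f′ u ≢ f′ w
    f′-proper {u} {w} u∈W w∈W u~w with u Fin.≟ v | w Fin.≟ v
    ... | yes refl | yes refl = contradiction u~w ~-irrefl
    ... | yes refl | no  _    = c-fresh w∈W u~w
    ... | no  _    | yes refl = ≢-sym (c-fresh u∈W (~-sym u~w))
    ... | no  u≢v  | no  w≢v  = f-proper (∈-filter⁺ (v ≢?_) u∈W u≢v) (∈-filter⁺ (v ≢?_) w∈W w≢v) u~w

  -- Vertices with fewer than `d` remaining neighbours are deleted one by one. If the list runs
  -- empty, the colouring is rebuilt in reverse order; otherwise what remains is a core.
  colourable-or-core : ∀ d W → Unique W → ColourableOn d W ⊎ Core d W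
  colourable-or-core d W W! = go (length W) W W! ≤-refl
    where
    -- The bound `k` makes the recursion structural: the filtered list is not a subterm of `W`.
    go : ∀ k W → Unique W → length W ≤ k → ColourableOn d W ⊎ Core d W
    go k       []        _  _    = inj₁ ((λ _ → 0) , (λ ()) , λ ())
    go (suc k) W@(w ∷ _) W! |W|≤ with Any.any? (λ x → length (nbrs x W) <? d) W
    ... | no  none = inj₂ record
      { vertices = W ; unique = W! ; ⊆-bound = id ; root = w ; root∈ = here refl
      ; degree≥ = λ x∈W → ≮⇒≥ (none ∘ lose x∈W) }
    ... | yes some with v , v∈W , deg<d ← find some
        with go k (filter (v ≢?_) W) (filter⁺ (v ≢?_) W!)
               (≤-pred (≤-trans (filter-notAll (v ≢?_) W (lose v∈W λ v≢v → v≢v refl)) |W|≤))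
    ... | inj₁ colouring = inj₁ (extend-colouring v deg<d colouring)
    ... | inj₂ core      = inj₂ record
      { Core core ; ⊆-bound = λ x∈ → proj₁ (∈-filter⁻ (v ≢?_) {xs = W} (Core.⊆-bound core x∈)) }

  -- The Moore bound

  module _ {e s W₀} (core : Core (suc e) W₀) (s≤girth : ∀ ℓ → Cycle H ℓ → s ≤ ℓ) where
    open Core core renaming (vertices to W; unique to W!)

    children : (y x : Fin n) → List (Fin n)
    children y x = filter (y ≢?_) (nbrs x W)

    ∈-children⁻ : ∀ {y x z} → z ∈ children y x → (x ~ z × z ≢ y) × z ∈ W
    ∈-children⁻ z∈ with z∈nbrs , z≢y ← ∈-filter⁻ _ z∈ with z∈W , x~z ← ∈-filter⁻ (_ ~?_) z∈nbrs
      = (x~z , z≢y) , z∈W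

    -- The endpoints of the non-backtracking walks with at most i vertices that
    -- start at x and whose second vertex is not y.
    tree : ℕ → (y x : Fin n) → List (Fin n)
    tree zero    y x = []
    tree (suc i) y x = x ∷ concatMap (tree i x) (children y x)

    ∈-subtree⁻ : ∀ i {y x w} → w ∈ concatMap (tree i x) (children y x) →
                 ∃[ z ] (z ∈ children y x × w ∈ tree i x z)
    ∈-subtree⁻ i w∈ = find (∈-concatMap⁻ (tree i _) w∈)

    tree⊆W : ∀ i {y x} → x ∈ W → tree i y x List.⊆ W
    tree⊆W (suc i) x∈W (here refl) = x∈W
    tree⊆W (suc i) x∈W (there w∈) with z , z∈ , w∈′ ← ∈-subtree⁻ i w∈ =
      tree⊆W i (proj₂ (∈-children⁻ z∈)) w∈′

    length-children : ∀ y {x} → x ∈ W → e ≤ length (children y x)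
    length-children y x∈W =
      ≤-pred (≤-trans (degree≥ x∈W) (length-filter-≢ y (filter⁺ _ W!)))

    length-tree : ∀ i {y x} → x ∈ W → geometric e i ≤ length (tree i y x)
    length-tree zero    x∈W = z≤n
    length-tree (suc i) {y} x∈W = ≤-trans (≤-reflexive (geometric-suc e i)) (s≤s
      (≤-trans (*-monoˡ-≤ (geometric e i) (length-children y x∈W))
        (length-concatMap-≥ _ λ z∈ → length-tree i (proj₂ (∈-children⁻ z∈)))))

    -- The walk is read off the recursion of `tree`. Starting it at the parent `y` records that it
    -- does not turn back there; `y` is left out of the length bound.
    tree-walk : ∀ i {y x w} → y ~ x → w ∈ tree i y x →
                ∃[ l ] (w ∈ x ∷ l × NonBacktracking (y ∷ x ∷ l) × length (x ∷ l) ≤ i)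
    tree-walk (suc i) y~x (here refl) = [] , here refl , edge y~x , s≤s z≤n
    tree-walk (suc i) y~x (there w∈)
      with z , z∈ , w∈′ ← ∈-subtree⁻ i w∈
      with (x~z , z≢y) , _ ← ∈-children⁻ z∈
      with l , w∈l , nb , |l|≤i ← tree-walk i x~z w∈′
      = z ∷ l , there w∈l , step y~x (≢-sym z≢y) nb , s≤s |l|≤i

    -- Putting the descent from `x` to `w` in front of the given walk yields a non-backtracking walk
    -- with at most `s` vertices, repetition-free by `nb⇒unique`. Each level moves one unit of the
    -- budget from `i` to the walk.
    tree-avoids-walk : ∀ i {y x l w} → NonBacktracking (x ∷ y ∷ l) → w ∈ tree i y x →
                       i + length (y ∷ l) ≤ s → w ∉ y ∷ l
    tree-avoids-walk (suc i) nb (here refl) i+|l|≤s w∈l =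
      Unique[x∷xs]⇒x∉xs (nb⇒unique s≤girth nb (≤-trans (s≤s (m≤n+m _ i)) i+|l|≤s)) w∈l
    tree-avoids-walk (suc i) nb (there w∈) i+|l|≤s w∈l
      with z , z∈ , w∈′ ← ∈-subtree⁻ i w∈
      with (x~z , z≢y) , _ ← ∈-children⁻ z∈
      = tree-avoids-walk i (step (~-sym x~z) z≢y nb) w∈′
          (≤-trans (≤-reflexive (+-suc i _)) i+|l|≤s) (there w∈l)

    -- A common vertex lies on a walk from `x` through `z`. With `z′` put in front, this walk is
    -- still non-backtracking because `z ≢ z′`, so the tree at `z′` must avoid it.
    trees-disjoint : ∀ i {x y y′ z z′} → i + suc i ≤ s →
                     z ∈ children y x → z′ ∈ children y′ x → z ≢ z′ →
                     Disjoint (tree i x z) (tree i x z′)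
    trees-disjoint i i+i<s z∈ z′∈ z≢z′ (w∈ , w∈′)
      with (x~z , _) , _ ← ∈-children⁻ z∈ | (x~z′ , _) , _ ← ∈-children⁻ z′∈
      with l , w∈l , nb , |l|≤i ← tree-walk i x~z w∈
      = tree-avoids-walk i (step (~-sym x~z′) (≢-sym z≢z′) nb) w∈′
          (≤-trans (+-monoʳ-≤ i (s≤s |l|≤i)) i+i<s) (there w∈l)

    -- Two descents of at most `i - 1` edges with the same endpoint would give a cycle of length at
    -- most `2i - 2`, which is below `s` exactly when `i + i ≤ suc s`.
    tree-unique : ∀ i {y x} → i + i ≤ suc s → Unique (tree i y x)
    tree-unique zero    _      = []
    tree-unique (suc i) {y} {x} (s≤s i+i<s) =
      ¬Any⇒All¬ _ root∉ ∷
      unique-concatMap (filter⁺ _ (filter⁺ _ W!))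
        (λ _ → tree-unique i (≤-trans (+-monoʳ-≤ i (n≤1+n i)) (m≤n⇒m≤1+n i+i<s)))
        (trees-disjoint i i+i<s)
      where
      root∉ : x ∉ concatMap (tree i x) (children y x)
      root∉ x∈ with z , z∈ , x∈′ ← ∈-subtree⁻ i x∈ with (x~z , _) , _ ← ∈-children⁻ z∈
        = tree-avoids-walk i (edge (~-sym x~z)) x∈′
            (≤-trans (+-monoʳ-≤ i (s≤s z≤n)) i+i<s) (here refl)

    -- A tree grown around one vertex: `suc e` branches at the root and `e` at later vertices. Its
    -- `suc a` levels exhaust the limit of `tree-unique`, as `2(a + 1) = s + 1`.
    moore-odd : ∀ a → s ≡ 1 + a * 2 → 1 + suc e * geometric e a ≤ length W
    moore-odd a refl = begin
      1 + suc e * geometric e a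
        ≤⟨ s≤s (*-monoˡ-≤ (geometric e a) (degree≥ root∈)) ⟩
      1 + length (nbrs root W) * geometric e a
        -- The root serves as its own parent; this forbids nothing, since no vertex is its own
        -- neighbour.
        ≡⟨ cong (λ l → 1 + length l * geometric e a) (filter-all _ (All.tabulate nbr≢root)) ⟨
      1 + length (children root root) * geometric e a
        ≤⟨ s≤s (length-concatMap-≥ _ λ z∈ → length-tree a (proj₂ (∈-children⁻ z∈))) ⟩
      length (tree (suc a) root root)
        ≤⟨ unique-⊆-length (tree-unique (suc a) (≤-reflexive radius)) (tree⊆W (suc a) root∈) ⟩
      length W ∎
      where
      open ≤-Reasoning
      nbr≢root : ∀ {z} → z ∈ nbrs root W → z ≢ root
      nbr≢root z∈ refl = ~-irrefl (proj₂ (∈-filter⁻ (root ~?_) {xs = W} z∈))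
      radius : suc a + suc a ≡ 2 + a * 2
      radius = trans (cong suc (+-suc a a))
        (cong (2 +_) (trans (cong (a +_) (sym (+-identityʳ a))) (*-comm 2 a)))

    -- Two trees grown from the ends of an edge, each away from the other end. A common vertex would
    -- give a cycle of length at most `2a - 1`, which is too short.
    moore-even : ∀ a → s ≡ a * 2 → 2 * geometric e a ≤ length W
    moore-even a refl with nbrs root W in eq | degree≥ root∈
    -- The degree bound `suc e` at `root` excludes an empty neighbour list.
    ... | v ∷ _ | _ = begin
      2 * geometric e a
        ≡⟨ cong (geometric e a +_) (+-identityʳ _) ⟩
      geometric e a + geometric e a
        ≤⟨ +-mono-≤ (length-tree a v∈W) (length-tree a root∈) ⟩
      length (tree a root v) + length (tree a v root)
        ≡⟨ length-++ (tree a root v) ⟨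
      length (tree a root v ++ tree a v root)
        ≤⟨ unique-⊆-length (++⁺ (tree-unique a a+a≤1+s) (tree-unique a a+a≤1+s) disjoint) ⊆W ⟩
      length W ∎
      where
      open ≤-Reasoning
      v∈ = ∈-filter⁻ (root ~?_) {xs = W} (subst (v ∈_) (sym eq) (here refl))
      v∈W = proj₁ v∈
      a+a≤s : a + a ≤ a * 2
      a+a≤s = ≤-reflexive (trans (cong (a +_) (sym (+-identityʳ a))) (*-comm 2 a))
      a+a≤1+s = m≤n⇒m≤1+n a+a≤s
      ⊆W : tree a root v ++ tree a v root List.⊆ W
      ⊆W w∈ with ∈-++⁻ (tree a root v) w∈
      ... | inj₁ p = tree⊆W a v∈W p
      ... | inj₂ p = tree⊆W a root∈ p
      disjoint : Disjoint (tree a root v) (tree a v root)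
      disjoint (w∈ , w∈′) with l , w∈l , nb , |l|≤a ← tree-walk a (proj₂ v∈) w∈ =
        tree-avoids-walk a nb w∈′ (≤-trans (+-monoʳ-≤ a |l|≤a) a+a≤s) w∈l

    moore-bound : moore s (suc e) ≤ length W
    moore-bound = by-parity (s % 2) (m%n<n s 2) (m≡m%n+[m/n]*n s 2)
      where
      -- Replacing `s % 2` by a variable `r` lets the `if` in `moore` reduce in each case.
      by-parity : ∀ r → r < 2 → s ≡ r + s / 2 * 2 →
        (if r ≡ᵇ 0 then 2 * geometric e (s / 2) else 1 + suc e * geometric e (s / 2)) ≤ length W
      by-parity 0 _ eq = moore-even (s / 2) eq
      by-parity 1 _ eq = moore-odd (s / 2) eq
      by-parity (suc (suc _)) (s≤s (s≤s ())) _

-- Deciding the existence of a cycle, and numbering the edges of a cycle.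

any-vec? : ∀ {n} k {P : Vec.Vec (Fin n) k → Set} → Decidable P → Dec (∃ P)
any-vec? zero    P? = map′ (λ p → Vec.[] , p) (λ { (Vec.[] , p) → p }) (P? Vec.[])
any-vec? (suc k) P? = map′ (λ (x , xs , p) → x Vec.∷ xs , p) (λ { (x Vec.∷ xs , p) → x , xs , p })
  (any? λ x → any-vec? k (P? ∘ (x Vec.∷_)))

cyclicSuc? : ∀ {ℓ} (i j : Fin ℓ) → Dec (CyclicSuc i j)
cyclicSuc? {ℓ} i j = toℕ j ≟ suc (toℕ i) ⊎-dec suc (toℕ i) ≟ ℓ ×-dec toℕ j ≟ 0

-- Exhaustive search over vertex sequences. They are vectors, and a cycle agrees with its table only
-- pointwise, so `from` transports along `look`.
cycle? : ∀ {n} (H : Graph n) ℓ → Dec (Cycle H ℓ)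
cycle? {n} H ℓ = map′ to from (any-vec? ℓ isCycle?)
  where
  open Graph H
  IsCycle : Vec.Vec (Fin n) ℓ → Set
  IsCycle v = 3 ≤ ℓ
    × (∀ i j → Vec.lookup v i ≡ Vec.lookup v j → i ≡ j)
    × (∀ i j → CyclicSuc i j → Vec.lookup v i ~ Vec.lookup v j)

  isCycle? : Decidable IsCycle
  isCycle? v = 3 ≤? ℓ
    ×-dec (all? λ i → all? λ j → Vec.lookup v i Fin.≟ Vec.lookup v j →-dec i Fin.≟ j)
    ×-dec (all? λ i → all? λ j → cyclicSuc? i j →-dec Vec.lookup v i ~? Vec.lookup v j)

  to : ∃ IsCycle → Cycle H ℓ
  to (v , 3≤ℓ , inj , adj) = record
    { 3≤length = 3≤ℓ ; vertex = Vec.lookup v ; injective = inj _ _ ; adjacent = adj _ _ }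

  from : Cycle H ℓ → ∃ IsCycle
  from C = Vec.tabulate vertex , 3≤length ,
    (λ i j eq → injective (trans (sym (look i)) (trans eq (look j)))) ,
    (λ i j i→j → subst₂ _~_ (sym (look i)) (sym (look j)) (adjacent i→j))
    where
    open Cycle C
    look = Vec.lookup∘tabulate vertex

module _ {n} {H : Graph n} {ℓ} (C : Cycle H ℓ) where
  open Graph H
  open Cycle C hiding (HasVertex; HasEdge)

  hasVertex? : Decidable (HasVertex C)
  hasVertex? v = any? λ i → v Fin.≟ vertex i

  hasEdge? : ∀ u v → Dec (HasEdge C u v)
  hasEdge? u v = any? λ i → any? λ j → cyclicSuc? i j ×-dec
    (u Fin.≟ vertex i ×-dec v Fin.≟ vertex j ⊎-dec u Fin.≟ vertex j ×-dec v Fin.≟ vertex i)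

  hasEdge-sym : ∀ {u v} → HasEdge C u v → HasEdge C v u
  hasEdge-sym (i , j , i→j , inj₁ (p , q)) = i , j , i→j , inj₂ (q , p)
  hasEdge-sym (i , j , i→j , inj₂ (p , q)) = i , j , i→j , inj₁ (q , p)

  hasEdge⇒~ : ∀ {u v} → HasEdge C u v → u ~ v
  hasEdge⇒~ (_ , _ , i→j , inj₁ (refl , refl)) = adjacent i→j
  hasEdge⇒~ (_ , _ , i→j , inj₂ (refl , refl)) = ~-sym (adjacent i→j)

  ∃-edge : ∀ i → ∃[ v ] HasEdge C (vertex i) v
  ∃-edge i with j , i→j ← ∃-cyclicSuc i = vertex j , i , j , i→j , inj₁ (refl , refl)

  hasVertex⇒V : ∀ {v} → HasVertex C v → V v
  hasVertex⇒V (i , refl) = ~⇒V (hasEdge⇒~ (proj₂ (∃-edge i)))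

  -- The position where the edge starts, together with the direction in which it is read: `2ℓ`
  -- ordered pairs for `ℓ` edges.
  edgeCode : ∀ {u v} → HasEdge C u v → Fin (ℓ * 2)
  edgeCode (i , _ , _ , inj₁ _) = combine i zero
  edgeCode (i , _ , _ , inj₂ _) = combine i (suc zero)

  -- The starting position determines the other end, by `cyclicSuc-functional`.
  edgeCode-injective : ∀ {u v u′ v′} (p : HasEdge C u v) (q : HasEdge C u′ v′) →
                       edgeCode p ≡ edgeCode q → (u , v) ≡ (u′ , v′)
  edgeCode-injective (i , _ , i→j , inj₁ (refl , refl)) (i′ , _ , i→j′ , inj₁ (refl , refl)) eq
    with refl , _ ← combine-injective i _ i′ _ eq
    with refl ← cyclicSuc-functional i→j i→j′ = refl
  edgeCode-injective (i , _ , i→j , inj₂ (refl , refl)) (i′ , _ , i→j′ , inj₂ (refl , refl)) eq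
    with refl , _ ← combine-injective i _ i′ _ eq
    with refl ← cyclicSuc-functional i→j i→j′ = refl
  edgeCode-injective (i , _ , _ , inj₁ _) (i′ , _ , _ , inj₂ _) eq
    with () ← proj₂ (combine-injective i zero i′ (suc zero) eq)
  edgeCode-injective (i , _ , _ , inj₂ _) (i′ , _ , _ , inj₁ _) eq
    with () ← proj₂ (combine-injective i (suc zero) i′ zero eq)

Cycle-mono : ∀ {n} {H G : Graph n} {ℓ} → H ⊆ G → Cycle H ℓ → Cycle G ℓ
Cycle-mono (_ , ~⊆) C = record { Cycle C ; adjacent = ~⊆ ∘ Cycle.adjacent C }

-- Maximal families of disjoint cycles

-- Pairwise related elements have distinct codes, so a family has at most `N` members and greedy
-- extension of the empty family must get stuck.
maximal-family : ∀ {A : Set} {N} {R : Rel A 0ℓ} → Symmetric R →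
  (code : A → Fin N) → (∀ {a b} → R a b → code a ≢ code b) →
  (Stuck : ∀ {t} → (Fin t → A) → Set) →
  (∀ {t} (C : Fin t → A) → (∃[ a ] (∀ i → R a (C i))) ⊎ Stuck C) →
  ∃[ t ] Σ[ C ∈ (Fin t → A) ] (Pairwise R C × Stuck C)
maximal-family {A} {N} {R} R-sym code separates Stuck extend =
  go N (λ ()) (λ ()) (≤-reflexive (sym (+-identityʳ N)))
  where
  pairwise-∷ : ∀ {t a} {C : Fin t → A} → (∀ i → R a (C i)) → Pairwise R C →
               Pairwise R (a Vector.∷ C)
  pairwise-∷ a# C# zero    zero    i≢j = contradiction refl i≢j
  pairwise-∷ a# C# zero    (suc j) _   = a# j
  pairwise-∷ a# C# (suc i) zero    _   = R-sym (a# i)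
  pairwise-∷ a# C# (suc i) (suc j) i≢j = C# i j (i≢j ∘ cong suc)

  size≤N : ∀ {t} {C : Fin t → A} → Pairwise R C → t ≤ N
  size≤N {C = C} C# = injective⇒≤ {f = code ∘ C} λ {i} {j} eq →
    decidable-stable (i Fin.≟ j) λ i≢j → separates (C# i j i≢j) eq

  go : ∀ k {t} (C : Fin t → A) → Pairwise R C → N ≤ k + t →
       ∃[ t ] Σ[ C ∈ (Fin t → A) ] (Pairwise R C × Stuck C)
  go k C C# N≤ with extend C
  go k       C C# N≤ | inj₂ stuck    = _ , C , C# , stuck
  -- Here `N ≤ t` already, so one more member would exceed the bound.
  go zero    C C# N≤ | inj₁ (a , a#) = contradiction (size≤N (pairwise-∷ a# C#)) (<⇒≱ (s≤s N≤))
  go (suc k) C C# N≤ | inj₁ (a , a#) =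
    go k (a Vector.∷ C) (pairwise-∷ a# C#) (≤-trans N≤ (≤-reflexive (sym (+-suc k _))))

module _ {n} (Y : Graph n) {s : ℕ} where
  open Graph Y

  module _ {t} (C : Fin t → Cycle Y s) where

    OnVertex : Fin n → Set
    OnVertex v = ∃[ i ] HasVertex (C i) v

    OnEdge : Rel (Fin n) 0ℓ
    OnEdge u v = ∃[ i ] HasEdge (C i) u v

    onVertex? : Decidable OnVertex
    onVertex? v = any? λ i → hasVertex? (C i) v

    onEdge? : ∀ u v → Dec (OnEdge u v)
    onEdge? u v = any? λ i → hasEdge? (C i) u v

    withoutVertices : Graph n
    withoutVertices = record
      { V        = λ v → V v × ¬ OnVertex v
      ; _~_      = λ u v → u ~ v × ¬ OnVertex u × ¬ OnVertex v
      ; V?       = λ v → V? v ×-dec ¬? (onVertex? v)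
      ; _~?_     = λ u v → u ~? v ×-dec ¬? (onVertex? u) ×-dec ¬? (onVertex? v)
      ; ~-sym    = λ (u~v , u∉ , v∉) → ~-sym u~v , v∉ , u∉
      ; ~-irrefl = ~-irrefl ∘ proj₁
      ; ~⇒V      = λ (u~v , u∉ , _) → ~⇒V u~v , u∉
      }

    withoutVertices-⊆ : withoutVertices ⊆ Y
    withoutVertices-⊆ = proj₁ , proj₁

    withoutEdges : Graph n
    withoutEdges = record
      { V        = V
      ; _~_      = λ u v → u ~ v × ¬ OnEdge u v
      ; V?       = V?
      ; _~?_     = λ u v → u ~? v ×-dec ¬? (onEdge? u v)
      ; ~-sym    = λ (u~v , uv∉) → ~-sym u~v , λ (i , vu) → uv∉ (i , hasEdge-sym (C i) vu)
      ; ~-irrefl = ~-irrefl ∘ proj₁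
      ; ~⇒V      = ~⇒V ∘ proj₁
      }

    withoutEdges-⊆ : withoutEdges ⊆ Y
    withoutEdges-⊆ = id , proj₁

    union : Graph n
    union = record
      { V        = V
      ; _~_      = OnEdge
      ; V?       = V?
      ; _~?_     = onEdge?
      ; ~-sym    = λ (i , uv) → i , hasEdge-sym (C i) uv
      ; ~-irrefl = λ (i , vv) → ~-irrefl (hasEdge⇒~ (C i) vv)
      ; ~⇒V      = λ (i , uv) → ~⇒V (hasEdge⇒~ (C i) uv)
      }

    union-⊆ : union ⊆ Y
    union-⊆ = id , λ (i , uv) → hasEdge⇒~ (C i) uv

    length≤-onVertices : ∀ {xs} → Unique xs → (∀ {x} → x ∈ xs → OnVertex x) → length xs ≤ t * s
    length≤-onVertices xs! on = unique-length-≤ xs! (code ∘ on) λ p q → code-injective (on p) (on q)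
      where
      code : ∀ {v} → OnVertex v → Fin (t * s)
      code (i , j , _) = combine i j
      code-injective : ∀ {u v} (p : OnVertex u) (q : OnVertex v) → code p ≡ code q → u ≡ v
      code-injective (i , j , refl) (i′ , j′ , refl) eq
        with refl , refl ← combine-injective i j i′ j′ eq = refl

    -- The factor `s * 2` arises because the list holds ordered pairs: each edge of a cycle may
    -- appear in both directions.
    length≤-onEdges : ∀ {xs} → Unique xs → (∀ {u v} → (u , v) ∈ xs → OnEdge u v) →
                      length xs ≤ t * (s * 2)
    length≤-onEdges xs! on = unique-length-≤ xs! (code ∘ on) λ p q → code-injective (on p) (on q)
      where
      code : ∀ {u v} → OnEdge u v → Fin (t * (s * 2))
      code (i , uv) = combine i (edgeCode (C i) uv)
      code-injective : ∀ {u v u′ v′} (p : OnEdge u v) (q : OnEdge u′ v′) →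
                       code p ≡ code q → (u , v) ≡ (u′ , v′)
      code-injective (i , uv) (i′ , uv′) eq
        with eqᵢ , eqₑ ← combine-injective i (edgeCode (C i) uv) i′ (edgeCode (C i′) uv′) eq
        with refl ← eqᵢ = edgeCode-injective (C i) uv uv′ eqₑ

  maximal-vertexDisjoint : 0 < s → ∃[ t ] Σ[ C ∈ (Fin t → Cycle Y s) ]
    (Pairwise VertexDisjoint C × ¬ Cycle (withoutVertices C) s)
  maximal-vertexDisjoint 0<s = maximal-family {R = VertexDisjoint}
    (λ CD v vD vC → CD v vC vD)
    -- The vertex at position zero tells vertex-disjoint cycles apart.
    (λ C → Cycle.vertex C i₀)
    (λ CD eq → CD _ (i₀ , refl) (i₀ , eq))
    (λ C → ¬ Cycle (withoutVertices C) s)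
    extend
    where
    i₀ : Fin s
    i₀ = fromℕ< 0<s

    extend : ∀ {t} (C : Fin t → Cycle Y s) →
             (∃[ D ] (∀ i → VertexDisjoint D (C i))) ⊎ ¬ Cycle (withoutVertices C) s
    extend C with cycle? (withoutVertices C) s
    ... | no  none = inj₂ none
    -- Every vertex of `D` lies off the family, so `D` extends it.
    ... | yes D    = inj₁ (Cycle-mono {G = Y} (withoutVertices-⊆ C) D ,
      λ i v vD vC → proj₂ (hasVertex⇒V D vD) (i , vC))

  maximal-edgeDisjoint : 0 < s → ∃[ t ] Σ[ C ∈ (Fin t → Cycle Y s) ]
    (Pairwise EdgeDisjoint C × ¬ Cycle (withoutEdges C) s)
  maximal-edgeDisjoint 0<s = maximal-family {R = EdgeDisjoint}
    (λ CD u v uvD uvC → CD u v uvC uvD)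
    firstEdge
    (λ {C} {D} → separates {C} {D})
    (λ C → ¬ Cycle (withoutEdges C) s)
    extend
    where
    i₀ : Fin s
    i₀ = fromℕ< 0<s

    -- The edge leaving position zero tells edge-disjoint cycles apart.
    firstEdge : Cycle Y s → Fin (n * n)
    firstEdge C = combine (Cycle.vertex C i₀) (proj₁ (∃-edge C i₀))

    separates : ∀ {C D} → EdgeDisjoint C D → firstEdge C ≢ firstEdge D
    separates {C} {D} CD eq =
      CD _ _ (proj₂ (∃-edge C i₀)) (subst₂ (HasEdge D) (sym eqᵤ) (sym eqᵥ) (proj₂ (∃-edge D i₀)))
      where
      eqs = combine-injective (Cycle.vertex C i₀) (proj₁ (∃-edge C i₀)) _ (proj₁ (∃-edge D i₀)) eq
      eqᵤ = proj₁ eqs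
      eqᵥ = proj₂ eqs

    extend : ∀ {t} (C : Fin t → Cycle Y s) →
             (∃[ D ] (∀ i → EdgeDisjoint D (C i))) ⊎ ¬ Cycle (withoutEdges C) s
    extend C with cycle? (withoutEdges C) s
    ... | no  none = inj₂ none
    ... | yes D    = inj₁ (Cycle-mono {G = Y} (withoutEdges-⊆ C) D ,
      λ i u v uvD uvC → proj₂ (hasEdge⇒~ D uvD) (i , uvC))

  -- Combining the colourings of the two pieces.

  colourable-sum : ∀ {t d q} (C : Fin t → Cycle Y s) →
    ColourableOn Y d (filter (onVertex? C) (allFin n)) → Colourable (withoutVertices C) q →
    Colourable Y (d + q)
  colourable-sum {d = d} {q} C (f , f<d , f-proper) (g , g<q , g-proper) = c , c< , c-proper
    where
    on⇒∈ : ∀ {v} → OnVertex C v → v ∈ filter (onVertex? C) (allFin n)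
    on⇒∈ = ∈-filter⁺ (onVertex? C) (∈-allFin _)

    -- Disjoint palettes: colours below `d` on the family, colours from `d` upwards elsewhere.
    c : Fin n → ℕ
    c v with onVertex? C v
    ... | yes _ = f v
    ... | no  _ = d + g v

    c< : ∀ {v} → V v → c v < d + q
    c< {v} v∈V with onVertex? C v
    ... | yes on  = ≤-trans (f<d (on⇒∈ on)) (m≤m+n d q)
    ... | no  off = +-monoʳ-< d (g<q (v∈V , off))

    low≢high : ∀ {u v} → OnVertex C u → f u ≢ d + g v
    low≢high on eq = <⇒≢ (<-≤-trans (f<d (on⇒∈ on)) (m≤m+n d _)) eq

    c-proper : ∀ {u v} → u ~ v → c u ≢ c v
    c-proper {u} {v} u~v with onVertex? C u | onVertex? C v
    ... | yes onᵤ  | yes onᵥ  = f-proper (on⇒∈ onᵤ) (on⇒∈ onᵥ) u~v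
    ... | yes onᵤ  | no  _    = low≢high onᵤ
    ... | no  _    | yes onᵥ  = ≢-sym (low≢high onᵥ)
    ... | no  offᵤ | no  offᵥ = g-proper (u~v , offᵤ , offᵥ) ∘ +-cancelˡ-≡ d _ _

  -- The ends of an edge are separated by `f` if it lies on a cycle of the family and by `g` if it
  -- survives the deletion, hence always by the pair.
  colourable-product : ∀ {t d q} .{{_ : NonZero d}} (C : Fin t → Cycle Y s) →
    ColourableOn (union C) d (allFin n) → Colourable (withoutEdges C) q → Colourable Y (q * d)
  colourable-product {d = d} {q} C (f , f<d , f-proper) (g , g<q , g-proper) = c , c< , c-proper
    where
    -- The pair in base `d`: the remainder recovers `f`, and cancelling it recovers `g`.
    c : Fin n → ℕ
    c v = f v + g v * d

    c< : ∀ {v} → V v → c v < q * d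
    c< {v} v∈V = <-≤-trans (+-monoˡ-< (g v * d) (f<d (∈-allFin v))) (*-monoˡ-≤ d (g<q v∈V))

    c%d : ∀ v → c v % d ≡ f v
    c%d v = trans ([m+kn]%n≡m%n (f v) (g v) d) (m<n⇒m%n≡m (f<d (∈-allFin v)))

    c-proper : ∀ {u v} → u ~ v → c u ≢ c v
    c-proper {u} {v} u~v eq with onEdge? C u v
    ... | yes on  = f-proper (∈-allFin u) (∈-allFin v) on
                      (trans (sym (c%d u)) (trans (cong (_% d) eq) (c%d v)))
    ... | no  off = g-proper (u~v , off) (*-cancelʳ-≡ (g u) (g v) d
      (+-cancelˡ-≡ (f v) _ _ (trans (cong (_+ g u * d) (sym fu≡fv)) eq)))
      where
      fu≡fv = trans (sym (c%d u)) (trans (cong (_% d) eq) (c%d v))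

-- Counting edges as ordered pairs of adjacent vertices.

darts : ∀ {n} (H : Graph n) (W : List (Fin n)) → List (Fin n × Fin n)
darts H W = concatMap (λ u → map (u ,_) (nbrs H u W)) W

∈-darts⁻ : ∀ {n} (H : Graph n) W {u v} → (u , v) ∈ darts H W → Graph._~_ H u v
∈-darts⁻ H W uv∈ with w , w∈W , uv∈′ ← find (∈-concatMap⁻ _ {xs = W} uv∈)
  with x , x∈ , refl ← ∈-map⁻ (w ,_) uv∈′ = proj₂ (∈-filter⁻ (Graph._~?_ H w) {xs = W} x∈)

darts-unique : ∀ {n} (H : Graph n) {W} → Unique W → Unique (darts H W)
darts-unique H {W} W! = unique-concatMap W!
  (λ {u} _ → map⁺ (cong proj₂) (filter⁺ (Graph._~?_ H u) W!))
  λ _ _ u≢v (p , q) → let _ , _ , eq = ∈-map⁻ _ p ; _ , _ , eq′ = ∈-map⁻ _ q in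
    u≢v (cong proj₁ (trans (sym eq) eq′))

length-darts : ∀ {n} (H : Graph n) {d W} → (∀ {x} → x ∈ W → d ≤ length (nbrs H x W)) →
               length W * d ≤ length (darts H W)
length-darts H {W = W} degree≥ = length-concatMap-≥ W λ {x} x∈W →
  ≤-trans (degree≥ x∈W) (≤-reflexive (sym (length-map (x ,_) (nbrs H x W))))

-- From the girth and chromatic hypotheses to the two packing bounds.

m∸n≡1+o⇒m≡n+[1+o] : ∀ m n {o} → m ∸ n ≡ suc o → m ≡ n + suc o
m∸n≡1+o⇒m≡n+[1+o] m       zero    eq = eq
m∸n≡1+o⇒m≡n+[1+o] (suc m) (suc n) eq = cong suc (m∸n≡1+o⇒m≡n+[1+o] m n eq)

girth≥ : ∀ {n s} (G : Graph n) → (∃[ g ] (IsGirth G g × [ s ]⊤ ≤⁺ g)) → ∀ ℓ → Cycle G ℓ → s ≤ ℓ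
girth≥ G (_ , (_ , least) , [ s≤g ]⁺) ℓ C = ≤-trans s≤g (least ℓ C)
girth≥ G (_ , acyclic , (_ ≤⊤⁺))      ℓ C = contradiction C (acyclic ℓ)

⊆-trans : ∀ {n} {F H G : Graph n} → F ⊆ H → H ⊆ G → F ⊆ G
⊆-trans (V₁ , E₁) (V₂ , E₂) = V₂ ∘ V₁ , E₂ ∘ E₁

theorem1p7 : ∀ {n} (s q h : ℕ) .{{_ : NonZero q}} → 3 ≤ s →
    (G : Graph n) → FirstFailing s q G →
    (Y : Graph n) → Y ⊆ G → IsChromaticNumber Y h →
    (∃[ t ] Σ[ C ∈ (Fin t → Cycle Y s) ]
    (Pairwise VertexDisjoint C × moore s (h ∸ q ∸ 1) ≤ s * t))
    ×
    (let c = ⌈ h / q ⌉ in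
    ∃[ t ] Σ[ C ∈ (Fin t → Cycle Y s) ]
    (Pairwise EdgeDisjoint C × (c ∸ 1) * moore s (c ∸ 1) ≤ 2 * s * t))
theorem1p7 {n} s q h 3≤s G (girth , colour) Y Y⊆G (_ , h-least) = vertexPart , edgePart
  where
  Y-girth : ∀ ℓ → Cycle Y ℓ → s ≤ ℓ
  Y-girth ℓ = girth≥ G girth ℓ ∘ Cycle-mono {G = G} Y⊆G

  vertexPart : ∃[ t ] Σ[ C ∈ (Fin t → Cycle Y s) ]
    (Pairwise VertexDisjoint C × moore s (h ∸ q ∸ 1) ≤ s * t)
  vertexPart with t , C , C# , none ← maximal-vertexDisjoint Y (≤-trans (s≤s z≤n) 3≤s)
    = t , C , C# , bound _ refl
    where
    -- The core is sought in `Y` restricted to the vertices of the family, so the girth bound for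
    -- `Y` applies directly.
    U = filter (onVertex? Y C) (allFin n)

    residual : Colourable (withoutVertices Y C) q
    residual = colour _ (⊆-trans {F = withoutVertices Y C} {Y} {G} (withoutVertices-⊆ Y C) Y⊆G) none

    -- Splitting on the value `d` makes `moore` reduce; at zero the bound is trivial.
    bound : ∀ d → h ∸ q ∸ 1 ≡ d → moore s d ≤ s * t
    bound zero    _  = z≤n
    bound (suc e) eq with colourable-or-core Y (suc e) U (filter⁺ _ (allFin⁺ n))
    -- The palettes have `suc e + q = h - 1` colours together, one fewer than the chromatic number.
    ... | inj₁ colouring = contradiction
      (h-least _ (colourable-sum Y C colouring residual)) (<⇒≱ (≤-reflexive h≡))
      where
      h≡ : suc (suc e + q) ≡ h
      h≡ = sym (trans (m∸n≡1+o⇒m≡n+[1+o] h q (m∸n≡1+o⇒m≡n+[1+o] (h ∸ q) 1 eq)) (+-comm q (2 + e)))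
    ... | inj₂ core = begin
      moore s (suc e)       ≤⟨ moore-bound Y core Y-girth ⟩
      length (Core.vertices core)
        ≤⟨ length≤-onVertices Y C (Core.unique core)
             (λ x∈ → proj₂ (∈-filter⁻ (onVertex? Y C) {xs = allFin n} (Core.⊆-bound core x∈))) ⟩
      t * s                 ≡⟨ *-comm t s ⟩
      s * t                 ∎
      where open ≤-Reasoning

  edgePart : let c = ⌈ h / q ⌉ in
    ∃[ t ] Σ[ C ∈ (Fin t → Cycle Y s) ]
    (Pairwise EdgeDisjoint C × (c ∸ 1) * moore s (c ∸ 1) ≤ 2 * s * t)
  edgePart with t , C , C# , none ← maximal-edgeDisjoint Y (≤-trans (s≤s z≤n) 3≤s)
    = t , C , C# , bound _ refl
    where
    residual : Colourable (withoutEdges Y C) q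
    residual = colour _ (⊆-trans {F = withoutEdges Y C} {Y} {G} (withoutEdges-⊆ Y C) Y⊆G) none

    F = union Y C

    bound : ∀ d → ⌈ h / q ⌉ ∸ 1 ≡ d → d * moore s d ≤ 2 * s * t
    bound zero    _  = z≤n
    -- All vertices may take part: one that lies on no cycle has degree zero in `F`, so it never
    -- enters a core of degree `suc e`.
    bound (suc e) eq with colourable-or-core F (suc e) (allFin n) (allFin⁺ n)
    ... | inj₁ colouring = contradiction
      (h-least _ (colourable-product Y C colouring residual)) (<⇒≱ qd<h)
      where
      c≡ : ⌈ h / q ⌉ ≡ 2 + e
      c≡ = m∸n≡1+o⇒m≡n+[1+o] ⌈ h / q ⌉ 1 eq
      -- This is `q * (c - 1) < h` for the ceiling `c`. Adding `q - 1` to both sides allows the use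
      -- of `c * q ≤ h + (q - 1)`; strictness comes from `q - 1 < q`.
      qd<h : q * suc e < h
      qd<h = +-cancelʳ-< (q ∸ 1) _ _ (begin-strict
        q * suc e + (q ∸ 1)  <⟨ +-monoʳ-< (q * suc e) (∸-monoʳ-< {q} {1} {0} (s≤s z≤n) (>-nonZero⁻¹ q)) ⟩
        q * suc e + q        ≡⟨ trans (+-comm _ q) (trans (sym (*-suc q (suc e))) (*-comm q (2 + e))) ⟩
        (2 + e) * q          ≡⟨ cong (_* q) c≡ ⟨
        ⌈ h / q ⌉ * q        ≤⟨ m/n*n≤m (h + (q ∸ 1)) q ⟩
        h + (q ∸ 1)          ∎)
        where open ≤-Reasoning
    ... | inj₂ core = begin
      suc e * moore s (suc e)
        ≤⟨ *-monoʳ-≤ (suc e) (moore-bound F core λ ℓ → Y-girth ℓ ∘ Cycle-mono {G = Y} (union-⊆ Y C)) ⟩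
      suc e * length W      ≡⟨ *-comm (suc e) (length W) ⟩
      -- The minimum degree turns the vertex count into a count of ordered pairs, which sees each
      -- edge twice; hence the factor 2 in the bound.
      length W * suc e      ≤⟨ length-darts F (Core.degree≥ core) ⟩
      length (darts F W)
        ≤⟨ length≤-onEdges Y C (darts-unique F (Core.unique core)) (∈-darts⁻ F W) ⟩
      t * (s * 2)           ≡⟨ trans (*-comm t _) (cong (_* t) (*-comm s 2)) ⟩
      2 * s * t             ∎
      where
      open ≤-Reasoning
      W = Core.vertices core
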